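{- For any integer $\gamma \geq 0$, $\mathsf{Dias}_\gamma$ is a basic operad.
   Context: Write $[\gamma] = \{1, \dots, \gamma\}$. A set-operad is a nonsymmetric operad in sets, described by partial compositions $\circ_i$ and a unit. $\mathsf{Dias}_\gamma$ is the set-operad generated by the two-letter words $0a$ and $a0$, $a \in [\gamma]$, inside the set-operad $\mathsf{T}\mathcal{M}_\gamma$ whose elements of arity $n \ge 1$ are all words of length $n$ on $\{0\} \cup [\gamma]$, with partial compositions $u \circ_i v := u_1 \dots u_{i-1}\,\max(u_i, v_1) \dots \max(u_i, v_m)\, u_{i+1} \dots u_n$ and unit the word $0$. For an operad $\mathcal{O}$, $x \in \mathcal{O}(n)$ and $y_1, \dots, y_n \in \mathcal{O}$, the composition map is $x \circ (y_1, \dots, y_n) := (\dots((x \circ_n y_n) \circ_{n-1} y_{n-1}) \dots) \circ_1 y_1$. A set-operad $\mathcal{O}$ is basic if for all $n \geq 1$ and all $y_1, \dots, y_n \in \mathcal{O}$, the map $\mathcal{O}(n) \to \mathcal{O}(|y_1| + \dots + |y_n|)$, $x \mapsto x \circ (y_1, \dots, y_n)$, is injective, where $|y|$ denotes the arity of $y$. -}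

module Defs where

import Algebra.Construct.NaturalChoice.Max as Max
open import Data.Fin.Base using (Fin; zero; suc; toℕ; fromℕ; inject₁; _↑ˡ_; _<_)
import Data.Fin.Properties as Fin
open import Data.Irrelevant using ([_])
open import Data.List.Base as List using (List; []; _∷_; _++_)
import Data.List.Properties as List
open import Data.Nat.Base as ℕ using (ℕ; zero; suc; pred; _+_; s≤s; s<s)
import Data.Nat.Properties as ℕ
open import Data.Product.Base using (∃; _,_)
open import Data.Refinement.Base using (Refinement-syntax; value; _,_)
open import Data.Vec.Base as Vec using (Vec; []; _∷_; toList)
import Data.Vec.Properties as Vec
open import Function.Definitions using (Injective)
open import Relation.Binary.PropositionalEquality

-- Arities are at least 1, so they are shifted: Op n is the set of
-- elements of arity suc n, and inputs are numbered from 0 by Fin (suc n).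
-- Elements of propositionally equal arities are compared in ∃ Op.

record SetOperad : Set₁ where
  infixl 6 _∘[_]_
  field
    Op     : ℕ → Set
    unit   : Op 0
    _∘[_]_ : ∀ {n m} → Op n → Fin (suc n) → Op m → Op (n + m)

  infix 4 _≋_
  _≋_ : ∀ {n m} → Op n → Op m → Set
  x ≋ y = _≡_ {A = ∃ Op} (_ , x) (_ , y)

  field
    identityˡ  : ∀ {n} (x : Op n) → unit ∘[ zero ] x ≋ x
    identityʳ  : ∀ {n} (x : Op n) (i : Fin (suc n)) → x ∘[ i ] unit ≋ x
    sequential : ∀ {n m l} (x : Op n) (y : Op m) (z : Op l)
                 (i : Fin (suc n)) (j : Fin (suc m))
                 (k : Fin (suc (n + m))) → toℕ k ≡ toℕ i + toℕ j →
                 (x ∘[ i ] y) ∘[ k ] z ≋ x ∘[ i ] (y ∘[ j ] z)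
    parallel   : ∀ {n m l} (x : Op n) (y : Op m) (z : Op l)
                 (i j : Fin (suc n)) → i < j →
                 (i′ : Fin (suc (n + l))) → toℕ i′ ≡ toℕ i →
                 (j′ : Fin (suc (n + m))) → toℕ j′ ≡ toℕ j + m →
                 (x ∘[ i ] y) ∘[ j′ ] z ≋ (x ∘[ j ] z) ∘[ i′ ] y

  arity : ∃ Op → ℕ
  arity (n , _) = suc n

  totalArity : ∀ {n} → Vec (∃ Op) n → ℕ
  totalArity ys = Vec.sum (Vec.map arity ys)

  -- Composes ys into the last suc k inputs of x (those numbered
  -- p, …, p + k), starting with the rightmost one.
  graft : ∀ p {k} → Op (p + k) → (ys : Vec (∃ Op) (suc k)) →
          Op (p + pred (totalArity ys))
  graft p x ((m , y) ∷ []) =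
    subst Op eq (x ∘[ fromℕ p ↑ˡ 0 ] y)
    where
    eq : p + 0 + m ≡ p + (m + 0)
    eq = trans (ℕ.+-assoc p 0 m) (cong (p +_) (ℕ.+-comm 0 m))
  graft p {suc k} x ((m , y) ∷ ys@(_ ∷ _)) =
    subst Op eq
      (graft (suc p) (subst Op (ℕ.+-suc p k) x) ys ∘[ inject₁ (fromℕ p ↑ˡ t) ] y)
    where
    t = pred (totalArity ys)

    eq : suc p + t + m ≡ p + (m + suc t)
    eq = trans (cong (_+ m) (sym (ℕ.+-suc p t)))
        (trans (ℕ.+-assoc p (suc t) m) (cong (p +_) (ℕ.+-comm (suc t) m)))

  infixl 6 _∘⟨_⟩
  _∘⟨_⟩ : ∀ {n} → Op n → (ys : Vec (∃ Op) (suc n)) → Op (pred (totalArity ys))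
  x ∘⟨ ys ⟩ = graft 0 x ys

IsBasic : SetOperad → Set
IsBasic O = ∀ {n} (ys : Vec (∃ Op) (suc n)) →
            Injective _≡_ _≡_ (λ (x : Op n) → x ∘⟨ ys ⟩)
  where open SetOperad O

module _ (O : SetOperad) (G : ∀ {n} → SetOperad.Op O n → Set) where

  open SetOperad O

  data Generated : ∀ {n} → Op n → Set where
    generator : ∀ {n} {x : Op n} → G x → Generated x
    identity  : Generated unit
    composite : ∀ {n m} {x : Op n} {y : Op m} →
                Generated x → (i : Fin (suc n)) → Generated y →
                Generated (x ∘[ i ] y)

  private
    GOp : ℕ → Set
    GOp n = [ x ∈ Op n ∣ Generated x ]

    lift : ∀ {n m} {x : GOp n} {y : GOp m} → value x ≋ value y →
           _≡_ {A = ∃ GOp} (_ , x) (_ , y)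
    lift refl = refl

  -- Membership in the suboperad is irrelevant, so that its elements are
  -- equal exactly when they are equal in O.
  generatedBy : SetOperad
  generatedBy = record
    { Op         = GOp
    ; unit       = unit , [ identity ]
    ; _∘[_]_     = λ { (x , [ gx ]) i (y , [ gy ]) →
                       x ∘[ i ] y , [ composite gx i gy ] }
    ; identityˡ  = λ x → lift (identityˡ (value x))
    ; identityʳ  = λ x i → lift (identityʳ (value x) i)
    ; sequential = λ x y z i j k eq →
        lift (sequential (value x) (value y) (value z) i j k eq)
    ; parallel   = λ x y z i j i<j i′ eq j′ eq′ →
        lift (parallel (value x) (value y) (value z) i j i<j i′ eq j′ eq′)
    }

module _ (γ : ℕ) where

  Letter : Set
  Letter = Fin (suc γ)

  Word : ℕ → Set
  Word n = Vec Letter (suc n)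

  open Max (Fin.≤-totalOrder (suc γ)) public
    using (_⊔_; ⊔-assoc; ⊔-identityˡ; ⊔-identityʳ)

  insert : ∀ {n m} → Vec Letter (suc n) → Fin (suc n) → Vec Letter (suc m) →
           Vec Letter (suc (n + m))
  insert {n} {m} (a ∷ u) zero v =
    Vec.cast (cong suc (ℕ.+-comm m n)) (Vec.map (a ⊔_) v Vec.++ u)
  insert (a ∷ u@(_ ∷ _)) (suc i) v = a ∷ insert u i v

  private
    infixl 6 _∘ₗ[_]_
    _∘ₗ[_]_ : List Letter → ℕ → List Letter → List Letter
    []      ∘ₗ[ _ ]     v = []
    (a ∷ u) ∘ₗ[ zero ]  v = List.map (a ⊔_) v ++ u
    (a ∷ u) ∘ₗ[ suc i ] v = a ∷ u ∘ₗ[ i ] v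

    ⊔-zeroˡ : ∀ (a : Letter) → zero ⊔ a ≡ a
    ⊔-zeroˡ = ⊔-identityˡ {zero} (λ _ → ℕ.z≤n)

    ⊔-zeroʳ : ∀ (a : Letter) → a ⊔ zero ≡ a
    ⊔-zeroʳ = ⊔-identityʳ {zero} (λ _ → ℕ.z≤n)

    toList-insert : ∀ {n m} (u : Word n) i (v : Word m) →
                    toList (insert u i v) ≡ toList u ∘ₗ[ toℕ i ] toList v
    toList-insert (a ∷ u) zero v =
      trans (Vec.toList-cast _ (Vec.map (a ⊔_) v Vec.++ u))
      (trans (Vec.toList-++ (Vec.map (a ⊔_) v) u)
             (cong (_++ toList u) (Vec.toList-map (a ⊔_) v)))
    toList-insert (a ∷ u@(_ ∷ _)) (suc i) v = cong (a ∷_) (toList-insert u i v)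

    fromToList : ∀ {n m} (u : Word n) (v : Word m) → toList u ≡ toList v →
                 _≡_ {A = ∃ Word} (n , u) (m , v)
    fromToList {n} {m} u v eq = aux n≡m (Vec.toList-injective (cong suc n≡m) u v eq)
      where
      n≡m : n ≡ m
      n≡m = ℕ.suc-injective (trans (sym (Vec.length-toList u))
              (trans (cong List.length eq) (Vec.length-toList v)))

      aux : ∀ {n m} {u : Word n} {v : Word m} (eq : n ≡ m) →
            Vec.cast (cong suc eq) u ≡ v → _≡_ {A = ∃ Word} (n , u) (m , v)
      aux {u = u} refl eq = cong (_ ,_) (trans (sym (Vec.cast-is-id refl u)) eq)

    identityₗˡ : ∀ v → (zero ∷ []) ∘ₗ[ 0 ] v ≡ v
    identityₗˡ v = trans (List.++-identityʳ _)
                         (trans (List.map-cong ⊔-zeroˡ v) (List.map-id v))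

    identityₗʳ : ∀ u i → u ∘ₗ[ i ] (zero ∷ []) ≡ u
    identityₗʳ []      i       = refl
    identityₗʳ (a ∷ u) zero    = cong (_∷ u) (⊔-zeroʳ a)
    identityₗʳ (a ∷ u) (suc i) = cong (a ∷_) (identityₗʳ u i)

    map-∘ₗ : ∀ a u v w {j} → j ℕ.< List.length v →
             (List.map (a ⊔_) v ++ u) ∘ₗ[ j ] w ≡ List.map (a ⊔_) (v ∘ₗ[ j ] w) ++ u
    map-∘ₗ a u (b ∷ v) w {zero} _ = begin
      List.map ((a ⊔ b) ⊔_) w ++ (List.map (a ⊔_) v ++ u)
        ≡⟨ cong (_++ _) (trans (List.map-cong (⊔-assoc a b) w) (List.map-∘ w)) ⟩
      List.map (a ⊔_) (List.map (b ⊔_) w) ++ (List.map (a ⊔_) v ++ u)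
        ≡⟨ List.++-assoc (List.map (a ⊔_) (List.map (b ⊔_) w)) _ u ⟨
      (List.map (a ⊔_) (List.map (b ⊔_) w) ++ List.map (a ⊔_) v) ++ u
        ≡⟨ cong (_++ u) (List.map-++ (a ⊔_) (List.map (b ⊔_) w) v) ⟨
      List.map (a ⊔_) (List.map (b ⊔_) w ++ v) ++ u ∎
      where open ≡-Reasoning
    map-∘ₗ a u (b ∷ v) w {suc j} (s≤s j<) = cong (a ⊔ b ∷_) (map-∘ₗ a u v w j<)

    sequentialₗ : ∀ u v w i {j} → j ℕ.< List.length v →
                  (u ∘ₗ[ i ] v) ∘ₗ[ i + j ] w ≡ u ∘ₗ[ i ] (v ∘ₗ[ j ] w)
    sequentialₗ []      v w i       j< = refl
    sequentialₗ (a ∷ u) v w zero    j< = map-∘ₗ a u v w j<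
    sequentialₗ (a ∷ u) v w (suc i) j< = cong (a ∷_) (sequentialₗ u v w i j<)

    ++-∘ₗ : ∀ u v w j → (u ++ v) ∘ₗ[ j + List.length u ] w ≡ u ++ (v ∘ₗ[ j ] w)
    ++-∘ₗ []      v w j = cong (v ∘ₗ[_] w) (ℕ.+-identityʳ j)
    ++-∘ₗ (a ∷ u) v w j rewrite ℕ.+-suc j (List.length u) = cong (a ∷_) (++-∘ₗ u v w j)

    parallelₗ : ∀ u v w {i j m} → i ℕ.< j → List.length v ≡ suc m →
                (u ∘ₗ[ i ] v) ∘ₗ[ j + m ] w ≡ (u ∘ₗ[ j ] w) ∘ₗ[ i ] v
    parallelₗ []      v w i<j       eq = refl
    parallelₗ (a ∷ u) v w {zero} {suc j} {m} i<j eq =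
      trans (cong ((List.map (a ⊔_) v ++ u) ∘ₗ[_] w) pos) (++-∘ₗ (List.map (a ⊔_) v) u w j)
      where
      pos : suc j + m ≡ j + List.length (List.map (a ⊔_) v)
      pos = trans (sym (ℕ.+-suc j m))
                  (cong (j +_) (sym (trans (List.length-map (a ⊔_) v) eq)))
    parallelₗ (a ∷ u) v w {suc i} {suc j} (s<s i<j) eq = cong (a ∷_) (parallelₗ u v w i<j eq)

    toList-insertˡ : ∀ {n m l} (u : Word n) i (v : Word m) k (w : Word l)
                     {p q} → toℕ i ≡ p → toℕ k ≡ q →
                     toList (insert (insert u i v) k w) ≡
                     (toList u ∘ₗ[ p ] toList v) ∘ₗ[ q ] toList w
    toList-insertˡ u i v k w refl refl =
      trans (toList-insert (insert u i v) k w)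
            (cong (_∘ₗ[ toℕ k ] toList w) (toList-insert u i v))

    toList-insertʳ : ∀ {n m l} (u : Word n) i (v : Word m) k (w : Word l) →
                     toList (insert u i (insert v k w)) ≡
                     toList u ∘ₗ[ toℕ i ] (toList v ∘ₗ[ toℕ k ] toList w)
    toList-insertʳ u i v k w =
      trans (toList-insert u i (insert v k w))
            (cong (toList u ∘ₗ[ toℕ i ]_) (toList-insert v k w))

  TM : SetOperad
  TM = record
    { Op         = Word
    ; unit       = zero ∷ []
    ; _∘[_]_     = insert
    ; identityˡ  = λ v → fromToList _ v
        (trans (toList-insert (zero ∷ []) zero v) (identityₗˡ (toList v)))
    ; identityʳ  = λ u i → fromToList _ u
        (trans (toList-insert u i (zero ∷ [])) (identityₗʳ (toList u) (toℕ i)))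
    ; sequential = λ u v w i j k eq → fromToList _ _
        (trans (toList-insertˡ u i v k w refl eq)
        (trans (sequentialₗ (toList u) (toList v) (toList w) (toℕ i)
                  (subst (toℕ j ℕ.<_) (sym (Vec.length-toList v)) (Fin.toℕ<n j)))
               (sym (toList-insertʳ u i v j w))))
    ; parallel   = λ u v w i j i<j i′ eq j′ eq′ → fromToList _ _
        (trans (toList-insertˡ u i v j′ w refl eq′)
        (trans (parallelₗ (toList u) (toList v) (toList w) i<j (Vec.length-toList v))
               (sym (toList-insertˡ u j w i′ v refl eq))))
    }

  -- suc a, for a : Fin γ, runs over the nonzero letters.
  data Generator : ∀ {n} → Word n → Set where
    zeroˡ : (a : Fin γ) → Generator (zero ∷ suc a ∷ [])
    zeroʳ : (a : Fin γ) → Generator (suc a ∷ zero ∷ [])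

  Dias : SetOperad
  Dias = generatedBy TM Generator

{-# OPTIONS --safe #-}
-- Every word of Dias γ contains the letter 0, since the generators do and
-- substitution preserves this.  As max(a, 0) = a, the letter of u at i can be
-- read off u ∘ᵢ v at any position where v has a 0, so each map u ↦ u ∘ᵢ v is
-- injective; the complete composition is a composite of such maps.
module Submission where

open import Defs
open import Data.Fin.Base using (Fin; zero; suc)
import Data.Fin.Properties as Fin
open import Data.Irrelevant using ([_])
open import Data.Nat.Base using (ℕ; zero; suc; z≤n)
open import Data.Product.Base using (∃; _,_)
open import Data.Refinement.Base using (value; _,_)
open import Data.Refinement.Properties using (value-injective)
open import Data.Vec.Base using (Vec; []; _∷_; _++_; cast; map)
open import Data.Vec.Membership.Propositional using (_∈_)
open import Data.Vec.Membership.Propositional.Properties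
  using (∈-map⁺; ∈-++⁺ˡ; ∈-++⁺ʳ)
import Data.Vec.Membership.DecPropositional as DecMembership
open import Data.Vec.Properties using (cast-sym; ++-injective; ∷-injective)
open import Data.Vec.Relation.Unary.Any using (here; there)
open import Function.Base using (_∘_)
open import Function.Definitions using (Injective)
open import Relation.Binary.PropositionalEquality
open import Relation.Nullary.Decidable using (recompute)

module _ (O : SetOperad) where

  open SetOperad O

  RightCancellative : Set
  RightCancellative = ∀ {n m} (i : Fin (suc n)) (y : Op m) →
                      Injective _≡_ _≡_ (λ (x : Op n) → x ∘[ i ] y)

  module _ (cancel : RightCancellative) where

    -- `graft` alternates partial compositions having a fixed right argument with transports along
    -- arity equations, and transports are injective too.
    graft-injective : ∀ p {k} (ys : Vec (∃ Op) (suc k)) →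
                      Injective _≡_ _≡_ (λ x → graft p x ys)
    graft-injective p ((m , y) ∷ []) =
      cancel _ y ∘ subst-injective _
    graft-injective p ((m , y) ∷ ys@(_ ∷ _)) =
      -- Read from right to left, this peels `graft` from the outside in; the last step undoes the
      -- transport from `p + suc k` to `suc p + k`.
      subst-injective _ ∘ graft-injective (suc p) ys ∘ cancel _ y ∘ subst-injective _

    rightCancellative⇒basic : IsBasic O
    rightCancellative⇒basic = graft-injective 0

module _ {A : Set} where

  cast-injective : ∀ {m n} .(eq : m ≡ n) → Injective _≡_ _≡_ (cast {A = A} eq)
  -- Casting back along `sym eq` is a left inverse.
  cast-injective eq p = trans (sym (cast-sym eq p)) (cast-sym eq refl)

  ∈-cast⁺ : ∀ {m n} .(eq : m ≡ n) {x : A} {xs : Vec A m} → x ∈ xs → x ∈ cast eq xs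
  ∈-cast⁺ {n = suc _} eq (here x≡y)   = here x≡y
  ∈-cast⁺ {n = suc _} eq (there x∈xs) = there (∈-cast⁺ _ x∈xs)

module _ {γ : ℕ} where

  private
    infixl 6 _⊔′_
    _⊔′_ : Letter γ → Letter γ → Letter γ
    _⊔′_ = _⊔_ γ

  ⊔-zeroʳ : ∀ (a : Letter γ) → a ⊔′ zero ≡ a
  ⊔-zeroʳ = ⊔-identityʳ γ {zero} (λ _ → z≤n)

  map-⊔-injective : ∀ {n} {v : Vec (Letter γ) n} → zero ∈ v →
                    Injective _≡_ _≡_ (λ a → map (a ⊔′_) v)
  map-⊔-injective (here refl) {a} {b} eq with p , _ ← ∷-injective eq =
    trans (sym (⊔-zeroʳ a)) (trans p (⊔-zeroʳ b))
  map-⊔-injective (there 0∈v) eq with _ , p ← ∷-injective eq =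
    map-⊔-injective 0∈v p

  -- The letters of `u` other than the one at `i` are copied unchanged, so only that one has to be
  -- recovered from the block replacing it.
  insert-injective : ∀ {n m} (i : Fin (suc n)) {v : Word γ m} → zero ∈ v →
                     Injective _≡_ _≡_ (λ (u : Word γ n) → insert γ u i v)
  insert-injective zero {v} 0∈v {a ∷ _} {b ∷ _} eq
    -- Both blocks have the length of `v`, so the equation splits at the same place.
    with p , q ← ++-injective (map (a ⊔′_) v) (map (b ⊔′_) v) (cast-injective _ eq) =
    cong₂ _∷_ (map-⊔-injective 0∈v p) q
  insert-injective (suc i) 0∈v {_ ∷ _ ∷ _} {_ ∷ _ ∷ _} eq
    with p , q ← ∷-injective eq =
    cong₂ _∷_ p (insert-injective i 0∈v q)

  0∈insert : ∀ {n m} {u : Word γ n} (i : Fin (suc n)) {v : Word γ m} →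
             zero ∈ u → zero ∈ v → zero ∈ insert γ u i v
  -- Only here is the 0 of `u` substituted into; a 0 of `v` then survives as max(0, 0).
  0∈insert zero        (here refl)  0∈v = ∈-cast⁺ _ (∈-++⁺ˡ (∈-map⁺ (zero ⊔′_) 0∈v))
  0∈insert zero {v}    (there 0∈u)  0∈v = ∈-cast⁺ _ (∈-++⁺ʳ (map _ v) 0∈u)
  0∈insert {u = _ ∷ _ ∷ _} (suc i) (here 0≡a)  0∈v = here 0≡a
  0∈insert {u = _ ∷ _ ∷ _} (suc i) (there 0∈u) 0∈v = there (0∈insert i 0∈u 0∈v)

  0∈generated : ∀ {n} {u : Word γ n} → Generated (TM γ) (Generator γ) u → zero ∈ u
  0∈generated (generator (zeroˡ a)) = here refl
  0∈generated (generator (zeroʳ a)) = there (here refl)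
  0∈generated identity              = here refl
  0∈generated (composite gu i gv)   = 0∈insert i (0∈generated gu) (0∈generated gv)

  open DecMembership (Fin._≟_ {suc γ}) using (_∈?_)

  Dias-rightCancellative : RightCancellative (Dias γ)
  Dias-rightCancellative i (v , [ gv ]) =
    value-injective ∘
    -- `gv` is irrelevant, so it cannot yield a position of 0 directly; as membership is decidable,
    -- a search through `v` supplies one.
    insert-injective i (recompute (zero ∈? v) (0∈generated gv)) ∘
    cong value

proposition2p3p3 : (γ : ℕ) → IsBasic (Dias γ)
proposition2p3p3 γ = rightCancellative⇒basic (Dias γ) Dias-rightCancellative
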